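{- Let $d=(d_1,\ldots,d_n)$ be a degree sequence with $n\ge 3$, and let $m=\frac12\sum_i d_i$. There is a bridge-less cactus realization of $d$ if and only if $m\le\lfloor 1.5(n-1)\rfloor$ and $d_i$ is even for every $i$.
   Context: A degree sequence is a sequence $d=(d_1,\ldots,d_n)$ of integers with $d_i\in\{1,\ldots,n-1\}$, even sum, and $d_1\ge\cdots\ge d_n$. A realization of $d$ is a simple graph on $\{1,\ldots,n\}$ in which vertex $i$ has degree $d_i$. A cactus is a connected simple graph in which every edge lies on at most one cycle; it is bridge-less if no edge's removal disconnects it. -}

module Defs where

open import Data.Bool using (Bool; false; T; _∧_; _∨_; not)
open import Data.Bool.Properties using (∧-comm; ∨-comm)
open import Data.Fin as Fin using (Fin; _≟_)
open import Data.Fin.Subset using (Subset; ∣_∣)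
open import Data.List as List using (List; []; _∷_; _∷ʳ_; length)
open import Data.List.Membership.Propositional using (_∈_)
open import Data.List.Relation.Unary.All using (All)
open import Data.List.Relation.Unary.Unique.Propositional using (Unique)
open import Data.Nat using (ℕ; _∸_; _≤_)
open import Data.Nat.Divisibility using (_∣_)
open import Data.Nat.DivMod using (_/_)
open import Data.Product using (_×_; _,_; uncurry)
open import Data.Sum using (_⊎_)
open import Data.Vec as Vec using (Vec; lookup; tabulate)
open import Function.Bundles using (_⇔_)
open import Relation.Binary.Construct.Closure.ReflexiveTransitive using (Star)
open import Relation.Binary.PropositionalEquality using (_≡_; trans; cong; cong₂)
open import Relation.Nullary.Decidable using (⌊_⌋)

record IsDegreeSequence {n : ℕ} (d : Vec ℕ n) : Set where
  field
    positive      : ∀ i → 1 ≤ lookup d i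
    bounded       : ∀ i → lookup d i ≤ n ∸ 1
    evenSum       : 2 ∣ Vec.sum d
    nonincreasing : ∀ i j → i Fin.≤ j → lookup d j ≤ lookup d i

-- The division is exact when d is a degree sequence.
halfSum : ∀ {n} → Vec ℕ n → ℕ
halfSum d = Vec.sum d / 2

-- The vertices 1, …, n are represented by Fin n.
record SimpleGraph (n : ℕ) : Set where
  field
    adj         : Fin n → Fin n → Bool
    symmetric   : ∀ u v → adj u v ≡ adj v u
    irreflexive : ∀ u → adj u u ≡ false

  Adj : Fin n → Fin n → Set
  Adj u v = T (adj u v)

  neighbours : Fin n → Subset n
  neighbours u = tabulate (adj u)

  degree : Fin n → ℕ
  degree u = ∣ neighbours u ∣

open SimpleGraph public

Realizes : ∀ {n} → SimpleGraph n → Vec ℕ n → Set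
Realizes G d = ∀ i → degree G i ≡ lookup d i

Connected : ∀ {n} → SimpleGraph n → Set
Connected G = ∀ u v → Star (Adj G) u v

-- The cyclic vertex list x₁, …, x_k has edges (x₁,x₂), …, (x_{k-1},x_k), (x_k,x₁).
cycleEdges : ∀ {n} → List (Fin n) → List (Fin n × Fin n)
cycleEdges []       = []
cycleEdges (x ∷ xs) = List.zip (x ∷ xs) (xs ∷ʳ x)

record IsCycle {n : ℕ} (G : SimpleGraph n) (c : List (Fin n)) : Set where
  field
    longEnough : 3 ≤ length c
    distinct   : Unique c
    adjacent   : All (uncurry (Adj G)) (cycleEdges c)

LiesOn : ∀ {n} → Fin n → Fin n → List (Fin n) → Set
LiesOn u v c = (u , v) ∈ cycleEdges c ⊎ (v , u) ∈ cycleEdges c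

-- Cycles are subgraphs: vertex lists that differ only by rotation or reversal
-- describe the same cycle, so cycles are compared by their edge sets.
SameCycle : ∀ {n} → List (Fin n) → List (Fin n) → Set
SameCycle c c′ = ∀ u v → LiesOn u v c ⇔ LiesOn u v c′

record IsCactus {n : ℕ} (G : SimpleGraph n) : Set where
  field
    connected      : Connected G
    atMostOneCycle : ∀ u v → Adj G u v →
                     ∀ c c′ → IsCycle G c → IsCycle G c′ →
                     LiesOn u v c → LiesOn u v c′ → SameCycle c c′

sameEdge : ∀ {n} → Fin n → Fin n → Fin n → Fin n → Bool
sameEdge u v x y = (⌊ x ≟ u ⌋ ∧ ⌊ y ≟ v ⌋) ∨ (⌊ x ≟ v ⌋ ∧ ⌊ y ≟ u ⌋)

removeEdge : ∀ {n} → SimpleGraph n → Fin n → Fin n → SimpleGraph n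
removeEdge G u v = record
  { adj         = λ x y → adj G x y ∧ not (sameEdge u v x y)
  ; symmetric   = λ x y → cong₂ _∧_ (symmetric G x y) (cong not (sameEdge-comm x y))
  ; irreflexive = λ x → cong (_∧ not (sameEdge u v x x)) (irreflexive G x)
  }
  where
  sameEdge-comm : ∀ x y → sameEdge u v x y ≡ sameEdge u v y x
  sameEdge-comm x y =
    trans (∨-comm (⌊ x ≟ u ⌋ ∧ ⌊ y ≟ v ⌋) (⌊ x ≟ v ⌋ ∧ ⌊ y ≟ u ⌋))
          (cong₂ _∨_ (∧-comm ⌊ x ≟ v ⌋ ⌊ y ≟ u ⌋) (∧-comm ⌊ x ≟ u ⌋ ⌊ y ≟ v ⌋))

-- Connectedness of a finite graph is decidable, so this is the same as saying
-- that no removeEdge G u v with Adj G u v is disconnected.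
Bridgeless : ∀ {n} → SimpleGraph n → Set
Bridgeless G = ∀ u v → Adj G u v → Connected (removeEdge G u v)

{-# OPTIONS --safe #-}
module Submission where

-- Necessity. Bridge-lessness puts every edge on a cycle, which is unique in a
-- cactus, so at each vertex v the neighbours are paired off by "the other
-- neighbour of v on the same cycle": degrees are even. Fix a spanning tree. The
-- cycle through a non-tree edge is its fundamental cycle, all of whose other
-- edges are tree edges, so the edges following and preceding the non-tree edges on
-- their cycles are tree edges, all different. Hence at most a third of the edges
-- lie outside the tree, that is, m ≤ 3(n − 1)/2.
--
-- Sufficiency. With dᵢ = 2 + 2eᵢ, start from the single vertex 0 and attach one
-- cycle on new vertices, taken in increasing order, at each entry of the list that
-- consists of 0 followed by eᵢ copies of every i in increasing order. All these
-- cycles are triangles except the last, which uses up the remaining vertices; the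
-- bound on m says that enough vertices remain, and monotonicity of d that a vertex
-- has been reached when its turn comes. A cycle of the enlarged graph is an old
-- cycle or the new one, because the attachment vertex separates them.

open import Data.Bool using (Bool; true; false; T)
open import Data.Bool.Properties using (T?)
open import Data.Empty using (⊥-elim)
open import Data.Fin as Fin using (Fin; _≟_)
import Data.Fin.Properties as Fin
open import Data.Fin.Subset using (∣_∣)
open import Data.List as List using (List; []; _∷_; _∷ʳ_; _++_; [_]; length; map; filter; allFin; cartesianProduct; concatMap; replicate; initLast; _∷ʳ′_)
import Data.List.Membership.DecPropositional as DecMembership
open import Data.List.Membership.Propositional using (_∈_; _∉_)
open import Data.List.Membership.Propositional.Properties
open import Data.List.Properties using (length-map; length-++; length-tabulate; length-replicate; map-cong; map-tabulate; filter-++; filter-accept; filter-reject; filter-none)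
open import Data.List.Relation.Binary.Permutation.Propositional using (_↭_; ↭⇒↭ₛ; ↭-sym; ↭-refl; ↭-trans; ↭-reflexive)
open import Data.List.Relation.Binary.Permutation.Propositional.Properties using (shift; ↭-length; ∈-resp-↭; ++-comm)
import Data.List.Relation.Binary.Permutation.Setoid.Properties as Perm
open import Data.List.Relation.Unary.All as All using (All; []; _∷_)
import Data.List.Relation.Unary.All.Properties as All
open import Data.List.Relation.Unary.AllPairs as AllPairs using (AllPairs; []; _∷_)
import Data.List.Relation.Unary.AllPairs.Properties as AllPairs
open import Data.List.Relation.Unary.Any using (here; there)
open import Data.List.Relation.Unary.Unique.Propositional using (Unique)
import Data.List.Relation.Unary.Unique.Propositional.Properties as Unique
open import Data.Nat as ℕ using (ℕ; zero; suc; _+_; _*_; _∸_; _≤_; _<_; z≤n; s≤s)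
open import Data.Nat.DivMod using (_/_; /-mono-≤; m/n*n≤m; m/n*n≡m)
open import Data.Nat.Divisibility using (_∣_; divides)
open import Data.Nat.ListAction using (sum)
import Data.Nat.Properties as ℕ
open import Data.Nat.Tactic.RingSolver using (solve-∀)
open import Data.Product using (_×_; _,_; ∃; ∃₂; proj₁; proj₂; uncurry; swap)
import Data.Product.Properties as Product
open import Data.Sum as Sum using (_⊎_; inj₁; inj₂; [_,_]′)
open import Data.Vec as Vec using (Vec; lookup)
open import Function using (_∘_; id)
open import Function.Bundles using (_⇔_; mk⇔; Equivalence)
open import Relation.Binary.Construct.Closure.ReflexiveTransitive as Star using (Star; ε; _◅_; _◅◅_)
open import Relation.Binary.PropositionalEquality using (_≡_; _≢_; refl; sym; trans; cong; cong₂; subst; setoid; module ≡-Reasoning)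
open import Relation.Nullary using (¬_; Dec; yes; no; does; ¬?)
open import Relation.Nullary.Decidable using (_⊎-dec_; does-⇔; dec-false)
open import Relation.Unary using (Decidable)
open import Defs

private variable
  A B : Set
  n : ℕ

-- Duplicate-free lists

unique-⊆⇒length-≤ : {xs ys : List A} → Unique xs → (∀ {x} → x ∈ xs → x ∈ ys) →
                    length xs ≤ length ys
unique-⊆⇒length-≤ {xs = []}     _          _   = z≤n
unique-⊆⇒length-≤ {xs = x ∷ xs} (x∉xs ∷ u) sub with ∈-∃++ (sub (here refl))
... | ps , qs , refl =
  subst (suc (length xs) ≤_) (sym (↭-length (shift x ps qs)))
    (s≤s (unique-⊆⇒length-≤ u rest))
  where
  -- Uniqueness keeps `x` out of the tail `xs`, so deleting one occurrence of `x` from the larger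
  -- list loses nothing that the tail needs.
  rest : ∀ {y} → y ∈ xs → y ∈ ps ++ qs
  rest y∈xs with ∈-resp-↭ (shift x ps qs) (sub (there y∈xs))
  ... | here refl = ⊥-elim (All.lookup x∉xs y∈xs refl)
  ... | there y∈  = y∈

Unique-resp-↭ : {xs ys : List A} → xs ↭ ys → Unique xs → Unique ys
Unique-resp-↭ {A = A} p =
  Perm.Unique-resp-↭ (setoid A) (↭⇒↭ₛ p)

-- Walks and cycles as edge lists

-- Only the interior vertices are listed, so every walk has at least one edge and a cycle is the
-- case of equal ends.
walkEdges : A → List A → A → List (A × A)
walkEdges x []       y = [ x , y ]
walkEdges x (z ∷ zs) y = (x , z) ∷ walkEdges z zs y

walkEdges-++ : ∀ (x : A) ps z qs y →
               walkEdges x (ps ++ z ∷ qs) y ≡ walkEdges x ps z ++ walkEdges z qs y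
walkEdges-++ x []       z qs y = refl
walkEdges-++ x (p ∷ ps) z qs y = cong ((x , p) ∷_) (walkEdges-++ p ps z qs y)

cycleEdges≡walkEdges : ∀ (x : Fin n) xs → cycleEdges (x ∷ xs) ≡ walkEdges x xs x
cycleEdges≡walkEdges x xs = go x xs
  where
  go : ∀ z zs → List.zip (z ∷ zs) (zs ∷ʳ x) ≡ walkEdges z zs x
  go z []        = refl
  go z (z′ ∷ zs) = cong ((z , z′) ∷_) (go z′ zs)

walkEdges-ends : ∀ (x : A) zs y {a b} → (a , b) ∈ walkEdges x zs y →
                 a ∈ x ∷ zs × b ∈ zs ∷ʳ y
walkEdges-ends x []       y (here refl) = here refl , here refl
walkEdges-ends x (z ∷ zs) y (here refl) = here refl , here refl
walkEdges-ends x (z ∷ zs) y (there e)   =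
  let a∈ , b∈ = walkEdges-ends z zs y e in there a∈ , there b∈

walkEdges-ends′ : ∀ (x : A) zs y {a b} → (a , b) ∈ walkEdges x zs y →
                  a ∈ x ∷ zs ∷ʳ y × b ∈ x ∷ zs ∷ʳ y
walkEdges-ends′ x zs y e =
  let a∈ , b∈ = walkEdges-ends x zs y e in ∈-++⁺ˡ a∈ , there b∈

-- Induction along a walk. `Q` will be membership in one side of a separation, or reachability from
-- a fixed vertex.
walk-closed : ∀ (Q : A → Set) (x : A) zs y →
              (∀ {a b} → (a , b) ∈ walkEdges x zs y → Q a → Q b) →
              Q x → All Q (x ∷ zs ∷ʳ y)
walk-closed Q x []       y step qx = qx ∷ step (here refl) qx ∷ []
walk-closed Q x (z ∷ zs) y step qx =
  qx ∷ walk-closed Q z zs y (step ∘ there) (step (here refl) qx)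

-- The list is cut in front of `x` and the two pieces are exchanged. A permutation of the edges is
-- enough, since only membership is read off from it.
rotate : ∀ {c : List (Fin n)} {x} → x ∈ c →
         ∃ λ rs → c ↭ x ∷ rs × cycleEdges c ↭ walkEdges x rs x
rotate {x = x} x∈c with ∈-∃++ x∈c
... | []     , qs , refl = qs , ↭-refl , ↭-reflexive (cycleEdges≡walkEdges x qs)
... | y ∷ ps , qs , refl = qs ++ y ∷ ps , ++-comm (y ∷ ps) (x ∷ qs) , edges
  where
  edges : cycleEdges (y ∷ ps ++ x ∷ qs) ↭ walkEdges x (qs ++ y ∷ ps) x
  edges rewrite cycleEdges≡walkEdges y (ps ++ x ∷ qs)
              | walkEdges-++ y ps x qs y | walkEdges-++ x qs y ps x
    = ++-comm (walkEdges y ps x) (walkEdges x qs y)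

-- The cyclic list c read off from its vertex x is x, w, mid, z.
record Around (c : List (Fin n)) (x : Fin n) : Set where
  field
    w z      : Fin n
    mid      : List (Fin n)
    distinct : Unique (x ∷ w ∷ mid ∷ʳ z)
    vertices : c ↭ x ∷ w ∷ mid ∷ʳ z
    edges    : cycleEdges c ↭ (x , w) ∷ walkEdges w mid z ∷ʳ (z , x)

  x∉rest : x ∉ w ∷ mid ∷ʳ z
  x∉rest x∈ with distinct
  ... | x≢ ∷ _ = All.lookup x≢ x∈ refl

  x≢w : x ≢ w
  x≢w x≡w = x∉rest (here x≡w)

  x≢z : x ≢ z
  x≢z x≡z = x∉rest (there (∈-++⁺ʳ mid (here x≡z)))

  w≢z : w ≢ z
  w≢z w≡z with distinct
  ... | _ ∷ w≢ ∷ _ = All.lookup w≢ (∈-++⁺ʳ mid (here refl)) w≡z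

  data Position (a b : Fin n) : Set where
    first : a ≡ x → b ≡ w → Position a b
    inner : (a , b) ∈ walkEdges w mid z → Position a b
    last  : a ≡ z → b ≡ x → Position a b

  position : ∀ {a b} → (a , b) ∈ cycleEdges c → Position a b
  position e∈ with ∈-resp-↭ edges e∈
  ... | here refl = first refl refl
  ... | there e∈′ with ∈-++⁻ (walkEdges w mid z) e∈′
  ...   | inj₁ e∈″         = inner e∈″
  ...   | inj₂ (here refl) = last refl refl

  first∈ : (x , w) ∈ cycleEdges c
  first∈ = ∈-resp-↭ (↭-sym edges) (here refl)

  inner∈ : ∀ {e} → e ∈ walkEdges w mid z → e ∈ cycleEdges c
  inner∈ e∈ = ∈-resp-↭ (↭-sym edges) (there (∈-++⁺ˡ e∈))

  last∈ : (z , x) ∈ cycleEdges c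
  last∈ = ∈-resp-↭ (↭-sym edges) (there (∈-++⁺ʳ (walkEdges w mid z) (here refl)))

  inner-avoids : ∀ {a b} → (a , b) ∈ walkEdges w mid z → a ≢ x × b ≢ x
  inner-avoids e =
    let a∈ , b∈ = walkEdges-ends′ w mid z e
    in (λ { refl → x∉rest a∈ }) , (λ { refl → x∉rest b∈ })

  -- `x` occurs once in the list, so only the first and the last edge meet it.
  two-neighbours : ∀ {y} → LiesOn x y c → y ≡ w ⊎ y ≡ z
  two-neighbours (inj₁ e) with position e
  ... | first _ y≡w   = inj₁ y≡w
  ... | inner i       = ⊥-elim (proj₁ (inner-avoids i) refl)
  ... | last x≡z y≡x  = inj₂ (trans y≡x x≡z)
  two-neighbours (inj₂ e) with position e
  ... | first y≡x x≡w = inj₁ (trans y≡x x≡w)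
  ... | inner i       = ⊥-elim (proj₂ (inner-avoids i) refl)
  ... | last y≡z _    = inj₂ y≡z

-- Length at least 3 makes the successor `w` and the predecessor `z` of `x` separate entries.
around : ∀ {c : List (Fin n)} {x} → 3 ≤ length c → Unique c → x ∈ c → Around c x
around {c = c} {x} 3≤ u x∈c with rotate x∈c
... | rs , vs , es with subst (3 ≤_) (↭-length vs) 3≤
... | s≤s 2≤ with rs
... | w ∷ rs′ with initLast rs′
around 3≤ u x∈c | rs , vs , es | s≤s (s≤s ()) | w ∷ .[] | []
around {x = x} 3≤ u x∈c | rs , vs , es | s≤s 2≤ | w ∷ .(mid ∷ʳ z) | mid ∷ʳ′ z = record
  { w = w ; z = z ; mid = mid
  ; distinct = Unique-resp-↭ vs u
  ; vertices = vs
  ; edges = ↭-trans es (↭-reflexive (cong ((x , w) ∷_) (walkEdges-++ w mid z [] x)))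
  }

aroundCycle : ∀ {G : SimpleGraph n} {c x} → IsCycle G c → x ∈ c → Around c x
aroundCycle C = around (IsCycle.longEnough C) (IsCycle.distinct C)

edge-ends : ∀ {c : List (Fin n)} {a b} → (a , b) ∈ cycleEdges c → a ∈ c × b ∈ c
edge-ends {c = x ∷ xs} e rewrite cycleEdges≡walkEdges x xs =
  let a∈ , b∈ = walkEdges-ends x xs x e in a∈ , [ there , (λ { (here refl) → here refl }) ]′ (∈-++⁻ xs b∈)

LiesOn-start : ∀ {c : List (Fin n)} {a b} → LiesOn a b c → a ∈ c
LiesOn-start = [ proj₁ ∘ edge-ends , proj₂ ∘ edge-ends ]′

Adj-sym : ∀ (G : SimpleGraph n) {a b} → Adj G a b → Adj G b a
Adj-sym G {a} {b} = subst T (symmetric G a b)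

Adj⇒≢ : ∀ (G : SimpleGraph n) {a b} → Adj G a b → a ≢ b
Adj⇒≢ G {a} ab refl = subst T (irreflexive G a) ab

LiesOn⇒Adj : ∀ {G : SimpleGraph n} {c a b} → IsCycle G c → LiesOn a b c → Adj G a b
LiesOn⇒Adj     C (inj₁ e) = All.lookup (IsCycle.adjacent C) e
LiesOn⇒Adj {G = G} C (inj₂ e) = Adj-sym G (All.lookup (IsCycle.adjacent C) e)

-- Read from `x`, the cycle is a closed walk, and following its edges forward passes through every
-- vertex.
cycle-closed : ∀ {c : List (Fin n)} (Q : Fin n → Set) {x} → x ∈ c → Q x →
               (∀ {a b} → (a , b) ∈ cycleEdges c → Q a → Q b) →
               ∀ {y} → y ∈ c → Q y
cycle-closed Q {x} x∈c qx step y∈c with rotate x∈c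
... | rs , vs , es =
  All.lookup (walk-closed Q x rs x (step ∘ ∈-resp-↭ (↭-sym es)) qx)
    (∈-++⁺ˡ (∈-resp-↭ vs y∈c))

-- A cycle minus one of its vertices u is still connected.
cycle-off-vertex : ∀ {G : SimpleGraph n} {c} → IsCycle G c → (u : Fin n) →
  {P : Fin n → Set} → (∀ x → Dec (P x)) →
  (∀ {a b} → (a , b) ∈ cycleEdges c → a ≢ u → b ≢ u → P a ⇔ P b) →
  (∀ {a} → a ∈ c → a ≢ u → P a) ⊎ (∀ {a} → a ∈ c → a ≢ u → ¬ P a)
cycle-off-vertex {n = n} {c = c} C u {P} P? iff with u ∈? c
  where open DecMembership (_≟_ {n}) using (_∈?_)
... | yes u∈c = Sum.map spread spread split
  where
  open Around (aroundCycle C u∈c)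
  spread : {Q : Fin n → Set} → All Q (w ∷ mid ∷ʳ z) → ∀ {a} → a ∈ c → a ≢ u → Q a
  spread qs a∈c a≢u with ∈-resp-↭ vertices a∈c
  ... | here a≡u = ⊥-elim (a≢u a≡u)
  ... | there a∈ = All.lookup qs a∈
  step : ∀ {a b} → (a , b) ∈ walkEdges w mid z → P a ⇔ P b
  step e = let a≢ , b≢ = inner-avoids e in iff (inner∈ e) a≢ b≢
  split : All P (w ∷ mid ∷ʳ z) ⊎ All (¬_ ∘ P) (w ∷ mid ∷ʳ z)
  split with P? w
  ... | yes pw = inj₁ (walk-closed P w mid z (Equivalence.to ∘ step) pw)
  ... | no ¬pw = inj₂ (walk-closed (¬_ ∘ P) w mid z (λ e ¬pa pb → ¬pa (Equivalence.from (step e) pb)) ¬pw)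
-- Nothing is deleted here: the first vertex of the list decides for the whole cycle.
... | no u∉c = split c refl
  where
  step : ∀ {a b} → (a , b) ∈ cycleEdges c → P a ⇔ P b
  step e = let a∈ , b∈ = edge-ends e in
    iff e (λ { refl → u∉c a∈ }) (λ { refl → u∉c b∈ })
  split : ∀ c′ → c′ ≡ c → (∀ {a} → a ∈ c → a ≢ u → P a) ⊎ (∀ {a} → a ∈ c → a ≢ u → ¬ P a)
  split []      refl = inj₁ λ ()
  split (x ∷ _) refl with P? x
  ... | yes px = inj₁ λ a∈ _ → cycle-closed P (here refl) px (Equivalence.to ∘ step) a∈
  ... | no ¬px = inj₂ λ a∈ _ → cycle-closed (¬_ ∘ P) (here refl) ¬px
      (λ e ¬pa pb → ¬pa (Equivalence.from (step e) pb)) a∈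

-- At a vertex of `c′` the two edges of `c′` are already the two edges that `c` has there. So `c`,
-- followed from a common vertex, never leaves `c′`.
subcycle : ∀ {G H : SimpleGraph n} {c c′} → IsCycle G c → IsCycle H c′ →
           (∀ {a b} → LiesOn a b c′ → LiesOn a b c) → SameCycle c′ c
subcycle {c = c} {c′} C C′ sub a b = mk⇔ sub back
  where
  keep : ∀ {x y} → x ∈ c′ → LiesOn x y c → LiesOn x y c′
  keep {x} x∈c′ xy =
    go (O.two-neighbours (sub (inj₁ I.first∈))) (O.two-neighbours (sub (inj₂ I.last∈))) (O.two-neighbours xy)
    where
    module I = Around (aroundCycle C′ x∈c′)
    module O = Around (aroundCycle C (LiesOn-start xy))
    go : ∀ {y} → I.w ≡ O.w ⊎ I.w ≡ O.z → I.z ≡ O.w ⊎ I.z ≡ O.z → y ≡ O.w ⊎ y ≡ O.z → LiesOn x y c′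
    go (inj₁ p) (inj₁ q) _           = ⊥-elim (I.w≢z (trans p (sym q)))
    go (inj₂ p) (inj₂ q) _           = ⊥-elim (I.w≢z (trans p (sym q)))
    go (inj₁ p) (inj₂ q) (inj₁ refl) = subst (λ y → LiesOn x y c′) p (inj₁ I.first∈)
    go (inj₁ p) (inj₂ q) (inj₂ refl) = subst (λ y → LiesOn x y c′) q (inj₂ I.last∈)
    go (inj₂ p) (inj₁ q) (inj₁ refl) = subst (λ y → LiesOn x y c′) q (inj₂ I.last∈)
    go (inj₂ p) (inj₁ q) (inj₂ refl) = subst (λ y → LiesOn x y c′) p (inj₁ I.first∈)

  start : ∀ c′ → 3 ≤ length c′ → ∃ λ x → x ∈ c′
  start (x ∷ _) _ = x , here refl

  covered : ∀ {y} → y ∈ c → y ∈ c′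
  covered with start c′ (IsCycle.longEnough C′)
  ... | x , x∈c′ =
    cycle-closed (_∈ c′) (LiesOn-start (sub (inj₁ (Around.first∈ (aroundCycle C′ x∈c′))))) x∈c′
      λ e a∈ → LiesOn-start (Sum.swap (keep a∈ (inj₁ e)))

  back : LiesOn a b c → LiesOn a b c′
  back ab = keep (covered (LiesOn-start ab)) ab

-- Removing an edge

SameEnds : Fin n → Fin n → Fin n → Fin n → Set
SameEnds u v a b = (a ≡ u × b ≡ v) ⊎ (a ≡ v × b ≡ u)

-- `v` is one of the two neighbours of `u` on the cycle. The inner walk between these avoids `u`,
-- and with the other edge at `u` it leads the long way round.
cycle-bypass : ∀ {G : SimpleGraph n} {c u v} → IsCycle G c → LiesOn u v c →
               Star (λ a b → LiesOn a b c × ¬ SameEnds u v a b) u v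
cycle-bypass {c = c} {u} {v} C uv = go (two-neighbours uv)
  where
  open Around (aroundCycle C (LiesOn-start uv))
  Off : Fin _ → Fin _ → Set
  Off a b = LiesOn a b c × ¬ SameEnds u v a b
  off-sym : ∀ {a b} → Off a b → Off b a
  off-sym (l , ¬s) = Sum.swap l , λ { (inj₁ (p , q)) → ¬s (inj₂ (q , p)) ; (inj₂ (p , q)) → ¬s (inj₁ (q , p)) }
  w→z : Star Off w z
  w→z = All.lookup
    (walk-closed (Star Off w) w mid z
      (λ e p → p ◅◅ ((inj₁ (inner∈ e) , λ { (inj₁ (p , _)) → proj₁ (inner-avoids e) p
                                           ; (inj₂ (_ , q)) → proj₂ (inner-avoids e) q }) ◅ ε)) ε)
    (there (∈-++⁺ʳ mid (here refl)))
  go : v ≡ w ⊎ v ≡ z → Star Off u v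
  go (inj₁ v≡w) = Star.reverse off-sym (subst (λ a → Star Off a u) (sym v≡w)
    (w→z ◅◅ ((inj₁ last∈ , λ { (inj₁ (p , _)) → x≢z (sym p)
                             ; (inj₂ (p , _)) → w≢z (trans (sym v≡w) (sym p)) }) ◅ ε)))
  go (inj₂ v≡z) = subst (Star Off u) (sym v≡z)
    ((inj₁ first∈ , λ { (inj₁ (_ , q)) → w≢z (trans q v≡z) ; (inj₂ (_ , q)) → x≢w (sym q) }) ◅ w→z)

module _ (G : SimpleGraph n) (u v : Fin n) where

  sameEdge-correct : ∀ a b → T (sameEdge u v a b) ⇔ SameEnds u v a b
  sameEdge-correct a b with a ≟ u | b ≟ v | a ≟ v | b ≟ u
  ... | yes p | yes q | _     | _     = mk⇔ (λ _ → inj₁ (p , q)) _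
  ... | yes p | no q  | yes r | yes s = mk⇔ (λ _ → inj₂ (r , s)) _
  ... | yes p | no q  | yes r | no s  = mk⇔ (λ ()) λ { (inj₁ (_ , x)) → q x ; (inj₂ (_ , x)) → s x }
  ... | yes p | no q  | no r  | _     = mk⇔ (λ ()) λ { (inj₁ (_ , x)) → q x ; (inj₂ (x , _)) → r x }
  ... | no p  | _     | yes r | yes s = mk⇔ (λ _ → inj₂ (r , s)) _
  ... | no p  | _     | yes r | no s  = mk⇔ (λ ()) λ { (inj₁ (x , _)) → p x ; (inj₂ (_ , x)) → s x }
  ... | no p  | _     | no r  | _     = mk⇔ (λ ()) λ { (inj₁ (x , _)) → p x ; (inj₂ (x , _)) → r x }

  removeEdge-adj : ∀ {a b} → Adj (removeEdge G u v) a b ⇔ (Adj G a b × ¬ SameEnds u v a b)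
  removeEdge-adj {a} {b} with adj G a b | sameEdge u v a b | sameEdge-correct a b
  ... | false | _     | _ = mk⇔ (λ ()) proj₁
  ... | true  | true  | s = mk⇔ (λ ()) λ (_ , ¬s) → ¬s (Equivalence.to s _)
  ... | true  | false | s = mk⇔ (λ _ → _ , Equivalence.from s) _

EdgesOnCycles : SimpleGraph n → Set
EdgesOnCycles G = ∀ {u v} → Adj G u v → ∃ λ c → IsCycle G c × LiesOn u v c

-- Any walk survives the removal of `uv` once each use of that edge is replaced by the rest of a
-- cycle through it.
edgesOnCycles⇒bridgeless : ∀ {G : SimpleGraph n} → Connected G → EdgesOnCycles G → Bridgeless G
edgesOnCycles⇒bridgeless {G = G} conn onCycle u v uv x y with onCycle uv
... | c , C , l = Star.kleisliStar id reroute (conn x y)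
  where
  G′ = removeEdge G u v
  bypass : Star (Adj G′) u v
  bypass = Star.map
    (λ (ab , ¬s) → Equivalence.from (removeEdge-adj G u v) (LiesOn⇒Adj C ab , ¬s))
    (cycle-bypass C l)
  reroute : ∀ {a b} → Adj G a b → Star (Adj G′) a b
  reroute {a} {b} ab with T? (sameEdge u v a b)
  ... | no ¬s = Equivalence.from (removeEdge-adj G u v)
                  (ab , ¬s ∘ Equivalence.from (sameEdge-correct G u v a b)) ◅ ε
  ... | yes s with Equivalence.to (sameEdge-correct G u v a b) s
  ...   | inj₁ (refl , refl) = bypass
  ...   | inj₂ (refl , refl) = Star.reverse (Adj-sym G′) bypass

-- Loop erasure

SimpleWalk : (A → A → Set) → A → A → Set
SimpleWalk R x y = ∃ λ zs → Unique (x ∷ zs ∷ʳ y) × All (uncurry R) (walkEdges x zs y)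

module _ {R : Fin n → Fin n → Set} where
  open DecMembership (_≟_ {n}) using (_∈?_)

  private
    suffix : ∀ {x z} zs {y} → x ∈ z ∷ zs → Unique (z ∷ zs ∷ʳ y) → All (uncurry R) (walkEdges z zs y) →
             SimpleWalk R x y
    suffix zs       (here refl) u       es       = zs , u , es
    suffix (_ ∷ zs) (there x∈)  (_ ∷ u) (_ ∷ es) = suffix zs x∈ u es

  -- If the new first vertex occurs in the walk already erased, the walk is cut back to that
  -- occurrence. Equal ends form a case of their own because a `SimpleWalk` has distinct ends.
  erase-loops : ∀ {x y} → Star R x y → x ≡ y ⊎ SimpleWalk R x y
  erase-loops ε = inj₁ refl
  erase-loops {x} {y} (_◅_ {j = z} xz zy) with x ≟ y | erase-loops zy
  ... | yes x≡y | _         = inj₁ x≡y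
  ... | no  x≢y | inj₁ refl = inj₂ ([] , (x≢y ∷ []) ∷ [] ∷ [] , xz ∷ [])
  ... | no  x≢y | inj₂ (zs , u , es) with x ∈? (z ∷ zs)
  ...   | yes x∈ = inj₂ (suffix zs x∈ u es)
  ...   | no  x∉ = inj₂ (z ∷ zs , All.tabulate fresh ∷ u , xz ∷ es)
    where
    fresh : ∀ {a} → a ∈ z ∷ zs ∷ʳ y → x ≢ a
    fresh a∈ refl with ∈-++⁻ (z ∷ zs) a∈
    ... | inj₁ a∈′        = x∉ a∈′
    ... | inj₂ (here x≡y) = x≢y x≡y

-- A loop-free `R`-walk from `u` to `v` is closed by the edge `uv`; `¬ R u v` rules out the one-edge
-- walk, so at least three vertices occur. The last component says that only the closing edge may
-- lie outside `R`.
close-cycle : ∀ (G : SimpleGraph n) {R : Fin n → Fin n → Set} {u v} →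
  (∀ {a b} → R a b → Adj G a b) → Adj G u v → ¬ R u v → Star R u v →
  ∃ λ c → IsCycle G c × LiesOn u v c ×
          (∀ {a b} → (a , b) ∈ cycleEdges c → R a b ⊎ (a ≡ v × b ≡ u))
close-cycle G R⊆ uv ¬Ruv walk with erase-loops walk
... | inj₁ refl = ⊥-elim (Adj⇒≢ G uv refl)
... | inj₂ ([] , _ , r ∷ []) = ⊥-elim (¬Ruv r)
close-cycle G {R} {u} {v} R⊆ uv ¬Ruv walk | inj₂ (z ∷ zs , uniq , es) =
  c , record { longEnough = s≤s (s≤s (∈-length (∈-++⁺ʳ zs {[ v ]} (here refl))))
             ; distinct = uniq
             ; adjacent = All.tabulate λ e → [ R⊆ , (λ { (refl , refl) → Adj-sym G uv }) ]′ (edge e) }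
    , inj₂ (subst ((v , u) ∈_) (sym split) (∈-++⁺ʳ (walkEdges u (z ∷ zs) v) (here refl)))
    , edge
  where
  c = u ∷ z ∷ zs ∷ʳ v
  split : cycleEdges c ≡ walkEdges u (z ∷ zs) v ∷ʳ (v , u)
  split = trans (cycleEdges≡walkEdges u (z ∷ zs ∷ʳ v)) (walkEdges-++ u (z ∷ zs) v [] u)
  edge : ∀ {a b} → (a , b) ∈ cycleEdges c → R a b ⊎ (a ≡ v × b ≡ u)
  edge {a} {b} e with ∈-++⁻ (walkEdges u (z ∷ zs) v) (subst ((a , b) ∈_) split e)
  ... | inj₁ e′          = inj₁ (All.lookup es e′)
  ... | inj₂ (here refl) = inj₂ (refl , refl)

-- Counting with filtered lists; degrees as list lengths

length-filter-¬ : {P : A → Set} (P? : Decidable P) (xs : List A) →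
                  length xs ≡ length (filter P? xs) + length (filter (¬? ∘ P?) xs)
length-filter-¬ P? []       = refl
length-filter-¬ P? (x ∷ xs) with P? x
... | yes _ = cong suc (length-filter-¬ P? xs)
... | no  _ = trans (cong suc (length-filter-¬ P? xs)) (sym (ℕ.+-suc _ _))

length-filter-map : {P : B → Set} (P? : Decidable P) (f : A → B) (xs : List A) →
                    length (filter P? (map f xs)) ≡ length (filter (P? ∘ f) xs)
length-filter-map P? f []       = refl
length-filter-map P? f (x ∷ xs) with P? (f x)
... | yes _ = cong suc (length-filter-map P? f xs)
... | no  _ = length-filter-map P? f xs

length-filter-× : {P : A × B → Set} (P? : Decidable P) (xs : List A) (ys : List B) →
  length (filter P? (cartesianProduct xs ys)) ≡ sum (map (λ x → length (filter (P? ∘ (x ,_)) ys)) xs)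
length-filter-× P? []       ys = refl
length-filter-× P? (x ∷ xs) ys =
  trans (cong length (filter-++ P? (map (x ,_) ys) (cartesianProduct xs ys)))
 (trans (length-++ (filter P? (map (x ,_) ys)))
        (cong₂ _+_ (length-filter-map P? (x ,_) ys) (length-filter-× P? xs ys)))

unique-length-≤n : {xs : List (Fin n)} → Unique xs → length xs ≤ n
unique-length-≤n {xs = xs} u =
  subst (length xs ≤_) (length-tabulate id) (unique-⊆⇒length-≤ u λ {x} _ → ∈-allFin x)

unique-sameElements⇒length-≡ : {xs ys : List A} → Unique xs → Unique ys →
  (∀ {x} → x ∈ xs → x ∈ ys) → (∀ {x} → x ∈ ys → x ∈ xs) → length xs ≡ length ys
unique-sameElements⇒length-≡ ux uy xs⊆ys ys⊆xs =
  ℕ.≤-antisym (unique-⊆⇒length-≤ ux xs⊆ys) (unique-⊆⇒length-≤ uy ys⊆xs)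

-- A fixed-point-free involution exchanges the entries with `x < f x` and those with `f x < x`, so
-- these halves have equal length.
even-length : {xs : List (Fin n)} → Unique xs → (f : Fin n → Fin n) → (∀ x → f (f x) ≡ x) →
              (∀ {x} → x ∈ xs → f x ∈ xs) → (∀ {x} → x ∈ xs → f x ≢ x) → 2 ∣ length xs
even-length {xs = xs} u f inv into noFix = divides (length up) (trans (length-filter-¬ up? xs) eq)
  where
  up? : Decidable (λ x → x Fin.< f x)
  up? x = x Fin.<? f x
  up down : List (Fin _)
  up   = filter up? xs
  down = filter (¬? ∘ up?) xs
  f-inj : ∀ {x y} → f x ≡ f y → x ≡ y
  f-inj {x} {y} eq = trans (sym (inv x)) (trans (cong f eq) (inv y))
  up→down : ∀ {y} → y ∈ map f up → y ∈ down
  up→down y∈ with ∈-map⁻ f y∈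
  ... | x , x∈ , refl with ∈-filter⁻ up? x∈
  ... | x∈xs , x<fx = ∈-filter⁺ (¬? ∘ up?) (into x∈xs)
    λ fx<ffx → ℕ.<-asym x<fx (subst (f x Fin.<_) (inv x) fx<ffx)
  down→up : ∀ {y} → y ∈ map f down → y ∈ up
  down→up y∈ with ∈-map⁻ f y∈
  ... | x , x∈ , refl with ∈-filter⁻ (¬? ∘ up?) {xs = xs} x∈
  ... | x∈xs , x≮fx = ∈-filter⁺ up? (into x∈xs)
    (subst (f x Fin.<_) (sym (inv x)) (Fin.≤∧≢⇒< (ℕ.≮⇒≥ x≮fx) (noFix x∈xs)))
  up≡down : length up ≡ length down
  up≡down = ℕ.≤-antisym
    (subst (_≤ length down) (length-map f up)
      (unique-⊆⇒length-≤ (Unique.map⁺ f-inj (Unique.filter⁺ up? u)) up→down))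
    (subst (_≤ length up) (length-map f down)
      (unique-⊆⇒length-≤ (Unique.map⁺ f-inj (Unique.filter⁺ (¬? ∘ up?) u)) down→up))
  eq : length up + length down ≡ length up * 2
  eq = trans (cong (length up +_) (trans (sym up≡down) (sym (ℕ.+-identityʳ _)))) (ℕ.*-comm 2 (length up))

neighbourList : SimpleGraph n → Fin n → List (Fin n)
neighbourList {n} G v = filter (λ u → T? (adj G v u)) (allFin n)

neighbourList-unique : ∀ (G : SimpleGraph n) v → Unique (neighbourList G v)
neighbourList-unique {n} G v = Unique.filter⁺ _ (Unique.allFin⁺ n)

∈-neighbourList : ∀ (G : SimpleGraph n) {v u} → u ∈ neighbourList G v ⇔ Adj G v u
∈-neighbourList {n} G {v} {u} =
  mk⇔ (proj₂ ∘ ∈-filter⁻ (λ u → T? (adj G v u)) {xs = allFin n})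
      (∈-filter⁺ (λ u → T? (adj G v u)) (∈-allFin u))

degree≡length-neighbourList : ∀ (G : SimpleGraph n) v → degree G v ≡ length (neighbourList G v)
degree≡length-neighbourList G v = go (adj G v) id
  where
  go : ∀ {m n} (f : Fin n → Bool) (g : Fin m → Fin n) →
       ∣ Vec.tabulate (f ∘ g) ∣ ≡ length (filter (T? ∘ f) (List.tabulate g))
  go {zero}  f g = refl
  go {suc m} f g with f (g Fin.zero)
  ... | true  = cong suc (go f (g ∘ Fin.suc))
  ... | false = go f (g ∘ Fin.suc)

degree≡length : ∀ (G : SimpleGraph n) {v} {us : List (Fin n)} → Unique us →
                (∀ {u} → u ∈ us ⇔ Adj G v u) → degree G v ≡ length us
degree≡length G {v} uniq nbr = trans (degree≡length-neighbourList G v)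
  (unique-sameElements⇒length-≡ (neighbourList-unique G v) uniq
    (Equivalence.from nbr ∘ Equivalence.to (∈-neighbourList G))
    (Equivalence.from (∈-neighbourList G) ∘ Equivalence.to nbr))

sum-lookup : ∀ (d : Vec ℕ n) → Vec.sum d ≡ sum (map (lookup d) (allFin n))
sum-lookup {n} d = trans (go d) (cong sum (sym (map-tabulate id (lookup d))))
  where
  go : ∀ {m} (d : Vec ℕ m) → Vec.sum d ≡ sum (List.tabulate (lookup d))
  go Vec.[]      = refl
  go (x Vec.∷ d) = cong (x +_) (go d)

-- Spanning trees

-- A tree is recorded by its growth, leaf by leaf: each edge brings one new vertex, which gives the
-- count in `tree-length`. Edges point away from the root.
data Tree (G : SimpleGraph n) (r : Fin n) : List (Fin n) → List (Fin n × Fin n) → Set where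
  root : Tree G r [ r ] []
  grow : ∀ {xs es u v} → Tree G r xs es → u ∈ xs → v ∉ xs → Adj G u v → Tree G r (v ∷ xs) ((u , v) ∷ es)

TreeEdge : List (Fin n × Fin n) → Fin n → Fin n → Set
TreeEdge es a b = (a , b) ∈ es ⊎ (b , a) ∈ es

module _ {G : SimpleGraph n} {r : Fin n} where

  tree-adj : ∀ {xs es} → Tree G r xs es → ∀ {a b} → TreeEdge es a b → Adj G a b
  tree-adj (grow t _ _ uv) (inj₁ (here refl)) = uv
  tree-adj (grow t _ _ uv) (inj₁ (there e))   = tree-adj t (inj₁ e)
  tree-adj (grow t _ _ uv) (inj₂ (here refl)) = Adj-sym G uv
  tree-adj (grow t _ _ uv) (inj₂ (there e))   = tree-adj t (inj₂ e)

  tree-unique : ∀ {xs es} → Tree G r xs es → Unique xs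
  tree-unique root            = [] ∷ []
  tree-unique (grow t _ v∉ _) = All.tabulate (λ { x∈ refl → v∉ x∈ }) ∷ tree-unique t

  tree-length : ∀ {xs es} → Tree G r xs es → length xs ≡ suc (length es)
  tree-length root           = refl
  tree-length (grow t _ _ _) = cong suc (tree-length t)

  tree-root : ∀ {xs es} → Tree G r xs es → r ∈ xs
  tree-root root           = here refl
  tree-root (grow t _ _ _) = there (tree-root t)

  tree-connected : ∀ {xs es} → Tree G r xs es → ∀ {x} → x ∈ xs → Star (TreeEdge es) r x
  tree-connected root            (here refl) = ε
  tree-connected (grow t u∈ _ _) (here refl) =
    Star.map (Sum.map there there) (tree-connected t u∈) ◅◅ (inj₁ (here refl) ◅ ε)
  tree-connected (grow t _ _ _)  (there x∈)  = Star.map (Sum.map there there) (tree-connected t x∈)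

module _ (G : SimpleGraph n) (conn : Connected G) (r : Fin n) where
  open DecMembership (_≟_ {n}) using (_∈?_)

  private
    -- The first step of the walk that leaves `xs` is the edge sought.
    crossing : ∀ {xs x y} → Star (Adj G) x y → x ∈ xs → y ∉ xs → ∃₂ λ a b → a ∈ xs × b ∉ xs × Adj G a b
    crossing ε x∈ y∉ = ⊥-elim (y∉ x∈)
    crossing {xs} (_◅_ {j = z} xz zy) x∈ y∉ with z ∈? xs
    ... | yes z∈ = crossing zy z∈ y∉
    ... | no  z∉ = _ , _ , x∈ , z∉ , xz

    -- `k` bounds the number of missing vertices. At `k = 0` the tree has `n` of them already, and a
    -- missing one would give a duplicate-free list of more than `n` vertices.
    extend : ∀ k {xs es} → n ≤ k + length xs → Tree G r xs es → ∃₂ λ xs es → Tree G r xs es × (∀ x → x ∈ xs)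
    extend k {xs} enough t with Fin.all? (_∈? xs)
    ... | yes full = _ , _ , t , full
    ... | no ¬full with Fin.¬∀⟶∃¬ n _ (_∈? xs) ¬full
    extend zero enough t | no _ | v , v∉ =
      ⊥-elim (ℕ.<⇒≱ (unique-length-≤n (All.tabulate (λ { x∈ refl → v∉ x∈ }) ∷ tree-unique t)) enough)
    extend (suc k) enough t | no _ | v , v∉ with crossing (conn r v) (tree-root t) v∉
    ... | a , b , a∈ , b∉ , ab =
      extend k (subst (n ≤_) (sym (ℕ.+-suc k _)) enough) (grow t a∈ b∉ ab)

  spanning-tree : ∃₂ λ xs es → Tree G r xs es × (∀ x → x ∈ xs)
  spanning-tree = extend n (ℕ.m≤m+n n _) root

-- Parity of the degrees and the edge bound

module _ (G : SimpleGraph n) (bridgeless : Bridgeless G) where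

  -- Without the edge `uv` there is still a walk from `u` to `v`, and `uv` closes it to a cycle.
  bridgeless⇒edgesOnCycles : EdgesOnCycles G
  bridgeless⇒edgesOnCycles {u} {v} uv
    with c , C , l , _ ← close-cycle G {R = Adj (removeEdge G u v)}
           (proj₁ ∘ Equivalence.to (removeEdge-adj G u v)) uv
           (λ r → proj₂ (Equivalence.to (removeEdge-adj G u v) r) (inj₁ (refl , refl)))
           (bridgeless u v uv u v)
    = c , C , l

module Necessity (G : SimpleGraph n) (cactus : IsCactus G) (bridgeless : Bridgeless G) where
  open IsCactus cactus

  sameCycle : ∀ {u v c c′} → IsCycle G c → IsCycle G c′ → LiesOn u v c → LiesOn u v c′ →
              ∀ {a b} → LiesOn a b c → LiesOn a b c′
  sameCycle C C′ l l′ = Equivalence.to (atMostOneCycle _ _ (LiesOn⇒Adj C l) _ _ C C′ l l′ _ _)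

  -- The cycle is quantified existentially, which makes the relation symmetric in `u` and `w`; that
  -- `w` does not depend on the cycle is `mate-unique`.
  Mate : Fin n → Fin n → Fin n → Set
  Mate v u w = w ≢ u × ∃ λ c → IsCycle G c × LiesOn v u c × LiesOn v w c

  mate-sym : ∀ {v u w} → Mate v u w → Mate v w u
  mate-sym (w≢u , c , C , vu , vw) = w≢u ∘ sym , c , C , vw , vu

  mate-exists : ∀ {v u} → Adj G v u → ∃ (Mate v u)
  mate-exists {v} {u} vu with bridgeless⇒edgesOnCycles G bridgeless vu
  ... | c , C , l = go (two-neighbours l)
    where
    open Around (aroundCycle C (LiesOn-start l))
    go : u ≡ w ⊎ u ≡ z → ∃ (Mate v u)
    go (inj₁ u≡w) = z , (λ z≡u → w≢z (sym (trans z≡u u≡w))) , c , C , l , inj₂ last∈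
    go (inj₂ u≡z) = w , (λ w≡u → w≢z (trans w≡u u≡z)) , c , C , l , inj₁ first∈

  -- Both cycles contain `vu`, so they agree. Then `u`, `w`, `w′` are all among the two neighbours
  -- of `v` on it, and `w`, `w′` differ from `u`.
  mate-unique : ∀ {v u w w′} → Mate v u w → Mate v u w′ → w ≡ w′
  mate-unique {v} {u} (w≢u , c , C , vu , vw) (w′≢u , c′ , C′ , vu′ , vw′) =
    go (two-neighbours vu) (two-neighbours vw) (two-neighbours (sameCycle C′ C vu′ vu vw′))
       w≢u w′≢u
    where
    open Around (aroundCycle C (LiesOn-start vu)) renaming (w to p; z to q; w≢z to p≢q)
    go : ∀ {u w w′} → u ≡ p ⊎ u ≡ q → w ≡ p ⊎ w ≡ q → w′ ≡ p ⊎ w′ ≡ q → w ≢ u → w′ ≢ u → w ≡ w′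
    go _           (inj₁ refl) (inj₁ refl) _ _ = refl
    go _           (inj₂ refl) (inj₂ refl) _ _ = refl
    go (inj₁ refl) (inj₁ refl) (inj₂ _)    w≢u _ = ⊥-elim (w≢u refl)
    go (inj₁ refl) (inj₂ _)    (inj₁ refl) _ w′≢u = ⊥-elim (w′≢u refl)
    go (inj₂ refl) (inj₁ _)    (inj₂ refl) _ w′≢u = ⊥-elim (w′≢u refl)
    go (inj₂ refl) (inj₂ refl) (inj₁ _)    w≢u _ = ⊥-elim (w≢u refl)

  -- Totalised by the identity outside the neighbourhood of v.
  mate : Fin n → Fin n → Fin n
  mate v u with T? (adj G v u)
  ... | yes vu = proj₁ (mate-exists vu)
  ... | no  _  = u

  mate-adjacent : ∀ {v u} → Adj G v u → Mate v u (mate v u)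
  mate-adjacent {v} {u} vu with T? (adj G v u)
  ... | yes vu′ = proj₂ (mate-exists vu′)
  ... | no ¬vu  = ⊥-elim (¬vu vu)

  mate-nonadjacent : ∀ {v u} → ¬ Adj G v u → mate v u ≡ u
  mate-nonadjacent {v} {u} ¬vu with T? (adj G v u)
  ... | yes vu = ⊥-elim (¬vu vu)
  ... | no _   = refl

  Mate-adj : ∀ {v u w} → Mate v u w → Adj G v w
  Mate-adj (_ , c , C , _ , vw) = LiesOn⇒Adj C vw

  mate-involutive : ∀ v u → mate v (mate v u) ≡ u
  mate-involutive v u with T? (adj G v u)
  ... | yes vu = let m = proj₂ (mate-exists vu) in mate-unique (mate-adjacent (Mate-adj m)) (mate-sym m)
  ... | no ¬vu = mate-nonadjacent ¬vu

  mate-injective : ∀ v {u u′} → mate v u ≡ mate v u′ → u ≡ u′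
  mate-injective v {u} {u′} eq =
    trans (sym (mate-involutive v u)) (trans (cong (mate v) eq) (mate-involutive v u′))

  degree-even : ∀ v → 2 ∣ degree G v
  degree-even v = subst (2 ∣_) (sym (degree≡length-neighbourList G v))
    (even-length (neighbourList-unique G v) (mate v) (mate-involutive v)
      (λ u∈ → Equivalence.from (∈-neighbourList G)
                (Mate-adj (mate-adjacent (Equivalence.to (∈-neighbourList G) u∈))))
      (λ u∈ → proj₁ (mate-adjacent (Equivalence.to (∈-neighbourList G) u∈))))

  module _ (r : Fin n) where

    private
      tree = spanning-tree G connected r
      xs = proj₁ tree
      es = proj₁ (proj₂ tree)
      t : Tree G r xs es
      t = proj₁ (proj₂ (proj₂ tree))

      Edge : Set
      Edge = Fin n × Fin n

      onTree? : Decidable (uncurry (TreeEdge es))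
      onTree? (a , b) = ((a , b) ∈? es) ⊎-dec ((b , a) ∈? es)
        where open DecMembership (Product.≡-dec (_≟_ {n}) (_≟_ {n})) using (_∈?_)

      tree-walk : ∀ u v → Star (TreeEdge es) u v
      tree-walk u v = Star.reverse Sum.swap (tree-connected t (full u)) ◅◅ tree-connected t (full v)
        where full = proj₂ (proj₂ (proj₂ tree))

      -- The cycle through a non-tree edge is its fundamental cycle.
      fundamental : ∀ {u v c} → IsCycle G c → LiesOn u v c → ¬ TreeEdge es u v →
                    ∀ {a b} → LiesOn a b c → TreeEdge es a b ⊎ SameEnds u v a b
      fundamental {u} {v} C uv ¬t ab
        with close-cycle G {R = TreeEdge es} (tree-adj t) (LiesOn⇒Adj C uv) ¬t (tree-walk u v)
      ... | c′ , C′ , uv′ , edge with sameCycle C C′ uv uv′ ab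
      ... | inj₁ e = Sum.map₂ inj₂ (edge e)
      ... | inj₂ e = Sum.map Sum.swap (λ (p , q) → inj₁ (q , p)) (edge e)

      -- For an edge `uv` of `G`, directed from `u` to `v`, these are the following and the
      -- preceding directed edge on its cycle.
      next prev : Edge → Edge
      next (u , v) = v , mate v u
      prev (u , v) = mate u v , u

      next-injective : ∀ {e e′} → next e ≡ next e′ → e ≡ e′
      next-injective {u , v} {u′ , v′} eq with Product.,-injective eq
      ... | refl , q = cong (_, v) (mate-injective v q)

      prev-injective : ∀ {e e′} → prev e ≡ prev e′ → e ≡ e′
      prev-injective {u , v} {u′ , v′} eq with Product.,-injective eq
      ... | q , refl = cong (u ,_) (mate-injective u q)

      Dart? : Decidable (uncurry (Adj G))
      Dart? (u , v) = T? (adj G u v)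

      -- Each edge is listed once in either direction, so that `length darts` is the sum of the
      -- degrees.
      darts treeDarts otherDarts : List Edge
      darts = filter Dart? (cartesianProduct (allFin n) (allFin n))
      treeDarts = filter onTree? darts
      otherDarts = filter (¬? ∘ onTree?) darts

      darts-unique : Unique darts
      darts-unique = Unique.filter⁺ Dart? (Unique.cartesianProduct⁺ (Unique.allFin⁺ n) (Unique.allFin⁺ n))

      ∈-treeDarts : ∀ {u v} → Adj G u v → TreeEdge es u v → (u , v) ∈ treeDarts
      ∈-treeDarts {u} {v} uv te =
        ∈-filter⁺ onTree? (∈-filter⁺ Dart? (∈-cartesianProduct⁺ (∈-allFin u) (∈-allFin v)) uv) te

      ∈-otherDarts : ∀ {u v} → (u , v) ∈ otherDarts → Adj G u v × ¬ TreeEdge es u v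
      ∈-otherDarts e∈ with ∈-filter⁻ (¬? ∘ onTree?) {xs = darts} e∈
      ... | e∈′ , ¬t = proj₂ (∈-filter⁻ Dart? {xs = cartesianProduct (allFin n) (allFin n)} e∈′) , ¬t

      -- The following edge lies on the fundamental cycle of `uv`, so it is a tree edge or `uv`
      -- itself. The latter fails because the mate of `u` at `v` is not `u`.
      next-tree : ∀ {u v} → (u , v) ∈ otherDarts → next (u , v) ∈ treeDarts
      next-tree {u} {v} e∈ with ∈-otherDarts e∈
      ... | uv , ¬t with mate-adjacent (Adj-sym G uv)
      ... | m@(w≢u , c , C , vu , vw) with fundamental C (Sum.swap vu) ¬t vw
      ... | inj₁ te              = ∈-treeDarts (Mate-adj m) te
      ... | inj₂ (inj₁ (v≡u , _)) = ⊥-elim (Adj⇒≢ G uv (sym v≡u))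
      ... | inj₂ (inj₂ (_ , w≡u)) = ⊥-elim (w≢u w≡u)

      prev-tree : ∀ {u v} → (u , v) ∈ otherDarts → prev (u , v) ∈ treeDarts
      prev-tree {u} {v} e∈ with ∈-otherDarts e∈
      ... | uv , ¬t with mate-adjacent uv
      ... | m@(w≢v , c , C , uv′ , uw) with fundamental C uv′ ¬t (Sum.swap uw)
      ... | inj₁ te              = ∈-treeDarts (Adj-sym G (Mate-adj m)) te
      ... | inj₂ (inj₁ (_ , u≡v)) = ⊥-elim (Adj⇒≢ G uv u≡v)
      ... | inj₂ (inj₂ (w≡v , _)) = ⊥-elim (w≢v w≡v)

      -- A common value is an edge of both cycles, which therefore agree. Having one non-tree edge
      -- only, the cycle forces `u′v′` to be `uv`, yet `u′` is the mate of `u` at `v` and so neither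
      -- `u` nor `v`.
      next≢prev : ∀ {e e′} → e ∈ otherDarts → e′ ∈ otherDarts → next e ≢ prev e′
      next≢prev {u , v} {u′ , v′} e∈ e′∈ eq
        with ∈-otherDarts e∈ | ∈-otherDarts e′∈
      ... | uv , ¬t | u′v′ , ¬t′
        with mate-adjacent (Adj-sym G uv) | mate-adjacent u′v′ | Product.,-injective eq
      ... | (w≢u , c , C , vu , vw) | (_ , c′ , C′ , l′ , k′) | v≡w′ , w≡u′
        with fundamental C (Sum.swap vu) ¬t
               (sameCycle C′ C (Sum.swap k′)
                 (subst (λ x → LiesOn x u′ c) v≡w′ (subst (λ x → LiesOn v x c) w≡u′ vw)) l′)
      ... | inj₁ te                = ¬t′ te
      ... | inj₂ (inj₁ (u′≡u , _)) = w≢u (trans w≡u′ u′≡u)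
      ... | inj₂ (inj₂ (u′≡v , _)) = Adj⇒≢ G (LiesOn⇒Adj C vw) (sym (trans w≡u′ u′≡v))

      otherDarts-bound : length otherDarts + length otherDarts ≤ length treeDarts
      otherDarts-bound = subst (_≤ length treeDarts)
        (trans (length-++ (map next otherDarts))
          (cong₂ _+_ (length-map next otherDarts) (length-map prev otherDarts)))
        (unique-⊆⇒length-≤
          (Unique.++⁺ (Unique.map⁺ next-injective uniq) (Unique.map⁺ prev-injective uniq) disjoint)
          (λ e∈ → [ intoTree next-tree , intoTree prev-tree ]′ (∈-++⁻ (map next otherDarts) e∈)))
        where
        uniq = Unique.filter⁺ (¬? ∘ onTree?) darts-unique
        intoTree : ∀ {f : Edge → Edge} → (∀ {u v} → (u , v) ∈ otherDarts → f (u , v) ∈ treeDarts) →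
                   ∀ {e} → e ∈ map f otherDarts → e ∈ treeDarts
        intoTree {f} into e∈ with ∈-map⁻ f e∈
        ... | _ , e′∈ , refl = into e′∈
        disjoint : ∀ {e} → ¬ (e ∈ map next otherDarts × e ∈ map prev otherDarts)
        disjoint (p , q) with ∈-map⁻ next p | ∈-map⁻ prev q
        ... | _ , e∈ , refl | _ , e′∈ , eq = next≢prev e∈ e′∈ eq

      treeDarts-bound : length treeDarts ≤ length es + length es
      treeDarts-bound = subst (length treeDarts ≤_)
        (trans (length-++ es) (cong (length es +_) (length-map swap es)))
        (unique-⊆⇒length-≤ (Unique.filter⁺ onTree? darts-unique) into)
        where
        into : ∀ {e} → e ∈ treeDarts → e ∈ es ++ map swap es
        into e∈ with ∈-filter⁻ onTree? {xs = darts} e∈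
        ... | _ , inj₁ e = ∈-++⁺ˡ e
        ... | _ , inj₂ e = ∈-++⁺ʳ es (∈-map⁺ swap e)

      darts-count : length darts ≡ sum (map (λ v → length (neighbourList G v)) (allFin n))
      darts-count = length-filter-× Dart? (allFin n) (allFin n)

      es-bound : length es ≤ n ∸ 1
      es-bound = ℕ.∸-monoˡ-≤ 1 (subst (_≤ n) (tree-length t) (unique-length-≤n (tree-unique t)))

      -- `D` counts all darts, `T` those on the tree, `B` the others, `E` the tree edges, and `N` is
      -- `n ∸ 1`. Doubling avoids division: `2D = 2T + 2B ≤ 3T ≤ 6N`.
      arithmetic : ∀ {D T B E N} → D ≡ T + B → B + B ≤ T → T ≤ E + E → E ≤ N → D ≤ 3 * N
      arithmetic {D} {T} {B} {E} {N} refl b t e = ℕ.*-cancelˡ-≤ 2 (begin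
        2 * (T + B)       ≡⟨ double T B ⟩
        (T + T) + (B + B) ≤⟨ ℕ.+-monoʳ-≤ (T + T) b ⟩
        (T + T) + T       ≤⟨ ℕ.+-mono-≤ (ℕ.+-mono-≤ T≤ T≤) T≤ ⟩
        ((N + N) + (N + N)) + (N + N) ≡⟨ six N ⟩
        2 * (3 * N)       ∎)
        where
        open ℕ.≤-Reasoning
        T≤ : T ≤ N + N
        T≤ = ℕ.≤-trans t (ℕ.+-mono-≤ e e)
        double : ∀ T B → 2 * (T + B) ≡ (T + T) + (B + B)
        double = solve-∀
        six : ∀ N → ((N + N) + (N + N)) + (N + N) ≡ 2 * (3 * N)
        six = solve-∀

    degree-sum-bound : sum (map (λ v → length (neighbourList G v)) (allFin n)) ≤ 3 * (n ∸ 1)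
    degree-sum-bound = subst (_≤ 3 * (n ∸ 1)) darts-count
      (arithmetic (length-filter-¬ onTree? darts) otherDarts-bound treeDarts-bound es-bound)

-- Attaching one cycle

module _ (R : Fin n → Fin n → Set) (R? : ∀ a b → Dec (R a b))
         (R-sym : ∀ {a b} → R a b → R b a) (R-irrefl : ∀ {a} → ¬ R a a) where

  relationGraph : SimpleGraph n
  relationGraph = record
    { adj         = λ a b → does (R? a b)
    ; symmetric   = λ a b → does-⇔ (mk⇔ R-sym R-sym) (R? a b) (R? b a)
    ; irreflexive = λ a → dec-false (R? a a) R-irrefl
    }

  relationGraph-adj : ∀ {a b} → Adj relationGraph a b ⇔ R a b
  relationGraph-adj {a} {b} with R? a b
  ... | yes r = mk⇔ (λ _ → r) _
  ... | no ¬r = mk⇔ (λ ()) ¬r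

-- A bridge-less cactus on the vertices `xs`, all others being isolated, so that every stage of the
-- construction is a graph on `Fin n`. Bridge-lessness takes the form `onCycles`.
record CactusOn (xs : List (Fin n)) (G : SimpleGraph n) : Set where
  field
    inside      : ∀ {a b} → Adj G a b → a ∈ xs
    connected   : ∀ {a b} → a ∈ xs → b ∈ xs → Star (Adj G) a b
    onCycles    : EdgesOnCycles G
    uniqueCycle : ∀ {u v c c′} → IsCycle G c → IsCycle G c′ →
                  LiesOn u v c → LiesOn u v c′ → SameCycle c c′

  isolated : ∀ {a} → a ∉ xs → degree G a ≡ 0
  isolated a∉ = degree≡length G [] (mk⇔ (λ ()) (⊥-elim ∘ a∉ ∘ inside))

emptyGraph : SimpleGraph n
emptyGraph = record { adj = λ _ _ → false ; symmetric = λ _ _ → refl ; irreflexive = λ _ → refl }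

emptyGraph-degree : (x : Fin n) → degree (emptyGraph {n}) x ≡ 0
emptyGraph-degree x = degree≡length emptyGraph {x} [] (mk⇔ (λ ()) λ ())

emptyGraph-cactusOn : (r : Fin n) → CactusOn [ r ] emptyGraph
emptyGraph-cactusOn r = record
  { inside      = λ ()
  ; connected   = λ { (here refl) (here refl) → ε }
  ; onCycles    = λ ()
  ; uniqueCycle = λ C _ l _ → ⊥-elim (LiesOn⇒Adj C l)
  }

module Attach {xs : List (Fin n)} {G : SimpleGraph n} (on : CactusOn xs G) {u : Fin n} (u∈xs : u ∈ xs)
              (zs : List (Fin n)) (zs-unique : Unique zs) (2≤zs : 2 ≤ length zs)
              (zs-new : ∀ {z} → z ∈ zs → z ∉ xs) where
  open CactusOn on
  open DecMembership (_≟_ {n}) using (_∈?_)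
  private module DecEdge = DecMembership (Product.≡-dec (_≟_ {n}) (_≟_ {n}))

  ring : List (Fin n)
  ring = u ∷ zs

  u∉zs : u ∉ zs
  u∉zs u∈zs = zs-new u∈zs u∈xs

  ring-unique : Unique ring
  ring-unique = All.tabulate (λ { z∈ refl → u∉zs z∈ }) ∷ zs-unique

  around-ring : ∀ {a} → a ∈ ring → Around ring a
  around-ring = around (s≤s 2≤zs) ring-unique

  LiesOn-irrefl : ∀ {a} → ¬ LiesOn a a ring
  LiesOn-irrefl aa = [ x≢w , x≢z ]′ (two-neighbours aa)
    where open Around (around-ring (LiesOn-start aa))

  Joined : Fin n → Fin n → Set
  Joined a b = Adj G a b ⊎ LiesOn a b ring

  joined? : ∀ a b → Dec (Joined a b)
  joined? a b = T? (adj G a b) ⊎-dec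
    (((a , b) DecEdge.∈? cycleEdges ring) ⊎-dec ((b , a) DecEdge.∈? cycleEdges ring))

  joined-sym : ∀ {a b} → Joined a b → Joined b a
  joined-sym = Sum.map (Adj-sym G) Sum.swap

  joined-irrefl : ∀ {a} → ¬ Joined a a
  joined-irrefl = [ (λ aa → Adj⇒≢ G aa refl) , LiesOn-irrefl ]′

  attached : SimpleGraph n
  attached = relationGraph Joined joined? joined-sym joined-irrefl

  attached-adj : ∀ {a b} → Adj attached a b ⇔ Joined a b
  attached-adj = relationGraph-adj Joined joined? joined-sym joined-irrefl

  old-edge : ∀ {a b} → Adj G a b → a ∉ zs
  old-edge ab a∈zs = zs-new a∈zs (inside ab)

  ring-end : ∀ {a b} → LiesOn a b ring → a ≢ u → a ∈ zs
  ring-end ab a≢u with LiesOn-start ab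
  ... | here a≡u = ⊥-elim (a≢u a≡u)
  ... | there a∈ = a∈

  -- `u` is the only old vertex of the ring, and no ring edge is a loop.
  ring-edge : ∀ {a b} → LiesOn a b ring → a ∈ zs ⊎ b ∈ zs
  ring-edge {a} {b} ab with a ≟ u
  ... | no a≢u = inj₁ (ring-end ab a≢u)
  ... | yes refl = inj₂ (ring-end (Sum.swap ab) λ { refl → LiesOn-irrefl ab })

  edges-disjoint : ∀ {a b} → Adj G a b → ¬ LiesOn a b ring
  edges-disjoint ab l = [ old-edge ab , old-edge (Adj-sym G ab) ]′ (ring-edge l)

  lift-cycle : ∀ {c} → IsCycle G c → IsCycle attached c
  lift-cycle C = record
    { longEnough = IsCycle.longEnough C
    ; distinct   = IsCycle.distinct C
    ; adjacent   = All.map (Equivalence.from attached-adj ∘ inj₁) (IsCycle.adjacent C)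
    }

  ring-cycle : IsCycle attached ring
  ring-cycle = record
    { longEnough = s≤s 2≤zs
    ; distinct   = ring-unique
    ; adjacent   = All.tabulate λ e → Equivalence.from attached-adj (inj₂ (inj₁ e))
    }

  -- The attachment vertex u separates the new vertices from the old ones.
  cycle-old-or-ring : ∀ {c} → IsCycle attached c → IsCycle G c ⊎ SameCycle c ring
  cycle-old-or-ring {c} C = [ inj₂ ∘ new , inj₁ ∘ old ]′ (cycle-off-vertex C u (_∈? zs) same-side)
    where
    joined : ∀ {a b} → LiesOn a b c → Joined a b
    joined = Equivalence.to attached-adj ∘ LiesOn⇒Adj C

    -- Away from `u`, an edge of `G` has two old ends and a ring edge two new ones.
    same-side : ∀ {a b} → (a , b) ∈ cycleEdges c → a ≢ u → b ≢ u → a ∈ zs ⇔ b ∈ zs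
    same-side e a≢u b≢u with joined (inj₁ e)
    ... | inj₁ ab = mk⇔ (⊥-elim ∘ old-edge ab) (⊥-elim ∘ old-edge (Adj-sym G ab))
    ... | inj₂ ab = mk⇔ (λ _ → ring-end (Sum.swap ab) b≢u) (λ _ → ring-end ab a≢u)

    -- An edge of `G` on `c` would have an end other than `u`, which is old and new at once. So all
    -- edges of `c` are ring edges.
    new : (∀ {a} → a ∈ c → a ≢ u → a ∈ zs) → SameCycle c ring
    new all-new = subcycle ring-cycle C on-ring
      where
      on-ring : ∀ {a b} → LiesOn a b c → LiesOn a b ring
      on-ring {a} {b} l with joined l
      ... | inj₂ ab = ab
      ... | inj₁ ab with a ≟ u
      ...   | no a≢u   = ⊥-elim (old-edge ab (all-new (LiesOn-start l) a≢u))
      ...   | yes refl = ⊥-elim (old-edge (Adj-sym G ab)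
                           (all-new (LiesOn-start {c = c} (Sum.swap l)) (Adj⇒≢ G ab ∘ sym)))

    old : (∀ {a} → a ∈ c → a ≢ u → a ∉ zs) → IsCycle G c
    old none-new = record
      { longEnough = IsCycle.longEnough C
      ; distinct   = IsCycle.distinct C
      ; adjacent   = All.tabulate in-G
      }
      where
      outside : ∀ {a} → a ∈ c → a ∉ zs
      outside a∈ a∈zs = none-new a∈ (λ { refl → u∉zs a∈zs }) a∈zs
      in-G : ∀ {e} → e ∈ cycleEdges c → uncurry (Adj G) e
      in-G e with joined (inj₁ e)
      ... | inj₁ ab = ab
      ... | inj₂ ab =
        ⊥-elim ([ outside (proj₁ (edge-ends e)) , outside (proj₂ (edge-ends e)) ]′ (ring-edge ab))

  attached-unique : ∀ {a b c c′} → IsCycle attached c → IsCycle attached c′ →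
                    LiesOn a b c → LiesOn a b c′ → SameCycle c c′
  attached-unique {a} {b} {c} {c′} C C′ l l′ = go (cycle-old-or-ring C) (cycle-old-or-ring C′)
    where
    go : IsCycle G c ⊎ SameCycle c ring → IsCycle G c′ ⊎ SameCycle c′ ring → SameCycle c c′
    go (inj₁ O) (inj₁ O′) = uniqueCycle {a} {b} O O′ l l′
    go (inj₂ s) (inj₂ s′) = λ x y → mk⇔ (Equivalence.from (s′ x y) ∘ Equivalence.to (s x y))
                                        (Equivalence.from (s x y) ∘ Equivalence.to (s′ x y))
    -- An old cycle and the ring have no edge in common.
    go (inj₁ O) (inj₂ s′) =
      ⊥-elim (edges-disjoint {a} {b} (LiesOn⇒Adj O l) (Equivalence.to (s′ a b) l′))
    go (inj₂ s) (inj₁ O′) =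
      ⊥-elim (edges-disjoint {a} {b} (LiesOn⇒Adj O′ l′) (Equivalence.to (s a b) l))

  attached-cactusOn : CactusOn (zs ++ xs) attached
  attached-cactusOn = record
    { inside      = λ ab → within (Equivalence.to attached-adj ab)
    ; connected   = λ a∈ b∈ → Star.reverse (Adj-sym attached) (from-u a∈) ◅◅ from-u b∈
    ; onCycles    = λ ab → onCycles′ (Equivalence.to attached-adj ab)
    ; uniqueCycle = attached-unique
    }
    where
    within : ∀ {a b} → Joined a b → a ∈ zs ++ xs
    within (inj₁ ab) = ∈-++⁺ʳ zs (inside ab)
    within (inj₂ ab) with LiesOn-start ab
    ... | here refl = ∈-++⁺ʳ zs u∈xs
    ... | there a∈  = ∈-++⁺ˡ a∈

    from-u : ∀ {a} → a ∈ zs ++ xs → Star (Adj attached) u a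
    from-u a∈ with ∈-++⁻ zs a∈
    ... | inj₂ a∈xs = Star.map (Equivalence.from attached-adj ∘ inj₁) (connected u∈xs a∈xs)
    ... | inj₁ a∈zs = cycle-closed {c = ring} (Star (Adj attached) u) (here refl) ε
      (λ e p → p ◅◅ (LiesOn⇒Adj ring-cycle (inj₁ e) ◅ ε)) (there a∈zs)

    onCycles′ : ∀ {a b} → Joined a b → ∃ λ c → IsCycle attached c × LiesOn a b c
    onCycles′ (inj₁ ab) with onCycles ab
    ... | c , C , l = c , lift-cycle C , l
    onCycles′ (inj₂ ab) = ring , ring-cycle , ab

  degree-off-ring : ∀ {a} → a ∉ ring → degree attached a ≡ degree G a
  degree-off-ring {a} a∉ = trans
    (degree≡length attached {a} (neighbourList-unique G a) (mk⇔ to from))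
    (sym (degree≡length-neighbourList G a))
    where
    to : ∀ {b} → b ∈ neighbourList G a → Adj attached a b
    to = Equivalence.from attached-adj ∘ inj₁ ∘ Equivalence.to (∈-neighbourList G)
    from : ∀ {b} → Adj attached a b → b ∈ neighbourList G a
    from ab = [ Equivalence.from (∈-neighbourList G) , ⊥-elim ∘ a∉ ∘ LiesOn-start ]′
                (Equivalence.to attached-adj ab)

  -- The two ring neighbours join the neighbours in `G`, and they are new ones because ring edges
  -- are not edges of `G`.
  degree-on-ring : ∀ {a} → a ∈ ring → degree attached a ≡ 2 + degree G a
  degree-on-ring {a} a∈ = trans
    (degree≡length attached {a} uniq (mk⇔ to from))
    (cong (2 +_) (sym (degree≡length-neighbourList G a)))
    where
    open Around (around-ring a∈)
    not-old : ∀ {b} → LiesOn a b ring → All (b ≢_) (neighbourList G a)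
    not-old l = All.tabulate λ { b∈ refl → edges-disjoint (Equivalence.to (∈-neighbourList G) b∈) l }
    uniq : Unique (w ∷ z ∷ neighbourList G a)
    uniq = (w≢z ∷ not-old (inj₁ first∈)) ∷ not-old (inj₂ last∈) ∷ neighbourList-unique G a
    to : ∀ {b} → b ∈ w ∷ z ∷ neighbourList G a → Adj attached a b
    to (here refl)         = Equivalence.from attached-adj (inj₂ (inj₁ first∈))
    to (there (here refl)) = Equivalence.from attached-adj (inj₂ (inj₂ last∈))
    to (there (there b∈))  = Equivalence.from attached-adj (inj₁ (Equivalence.to (∈-neighbourList G) b∈))
    from : ∀ {b} → Adj attached a b → b ∈ w ∷ z ∷ neighbourList G a
    from ab with Equivalence.to attached-adj ab
    ... | inj₁ old = there (there (Equivalence.from (∈-neighbourList G) old))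
    ... | inj₂ l   = [ here , there ∘ here ]′ (two-neighbours l)

-- Lists with prescribed multiplicities

occurrences : Fin n → List (Fin n) → ℕ
occurrences x as = length (filter (x ≟_) as)

occurrences-here : ∀ (x : Fin n) as → occurrences x (x ∷ as) ≡ suc (occurrences x as)
occurrences-here x as = cong length (filter-accept (x ≟_) refl)

occurrences-there : ∀ {x y : Fin n} as → x ≢ y → occurrences x (y ∷ as) ≡ occurrences x as
occurrences-there {x = x} as x≢y = cong length (filter-reject (x ≟_) x≢y)

occurrences-none : ∀ {x : Fin n} {as} → All (x ≢_) as → occurrences x as ≡ 0
occurrences-none {x = x} x∉ = cong length (filter-none (x ≟_) x∉)

occurrences-++ : ∀ (x : Fin n) as bs → occurrences x (as ++ bs) ≡ occurrences x as + occurrences x bs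
occurrences-++ x as bs = trans (cong length (filter-++ (x ≟_) as bs)) (length-++ (filter (x ≟_) as))

repeat : (Fin n → ℕ) → List (Fin n) → List (Fin n)
repeat e = concatMap (λ i → replicate (e i) i)

occurrences-replicate : ∀ (x : Fin n) k → occurrences x (replicate k x) ≡ k
occurrences-replicate x zero    = refl
occurrences-replicate x (suc k) =
  trans (occurrences-here x (replicate k x)) (cong suc (occurrences-replicate x k))

repeat-⊆ : ∀ (e : Fin n → ℕ) is {x} → x ∈ repeat e is → x ∈ is
repeat-⊆ e (i ∷ is) x∈ with ∈-++⁻ (replicate (e i) i) x∈
... | inj₁ x∈i  = here (All.lookup {P = _≡ i} (All.replicate⁺ (e i) refl) x∈i)
... | inj₂ x∈is = there (repeat-⊆ e is x∈is)

occurrences-repeat : ∀ (e : Fin n → ℕ) {is} → Unique is → ∀ {x} → x ∈ is → occurrences x (repeat e is) ≡ e x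
occurrences-repeat e {i ∷ is} (i∉ ∷ u) {x} x∈ with occurrences-++ x (replicate (e i) i) (repeat e is) | x∈
... | eq | here refl = trans eq (trans (cong₂ _+_ (occurrences-replicate i (e i))
  (occurrences-none (All.tabulate λ y∈ → All.lookup i∉ (repeat-⊆ e is y∈)))) (ℕ.+-identityʳ (e i)))
... | eq | there x∈′ = trans eq (cong₂ _+_
  (occurrences-none (All.replicate⁺ (e i) (All.lookup i∉ x∈′ ∘ sym))) (occurrences-repeat e u x∈′))

-- The right side is the degree sum for degrees `2 + 2 * e i`, so this counts the cycles to be
-- attached in terms of the number of edges.
length-repeat : ∀ (e : Fin n → ℕ) is →
                2 * length (repeat e is) + 2 * length is ≡ sum (map (λ i → 2 + 2 * e i) is)
length-repeat e []       = refl
length-repeat e (i ∷ is) = begin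
  2 * length (replicate (e i) i ++ repeat e is) + 2 * suc (length is)
    ≡⟨ cong (λ l → 2 * l + 2 * suc (length is))
         (trans (length-++ (replicate (e i) i))
                (cong (_+ length (repeat e is)) (length-replicate (e i)))) ⟩
  2 * (e i + length (repeat e is)) + 2 * suc (length is)
    ≡⟨ rearrange (e i) (length (repeat e is)) (length is) ⟩
  2 + 2 * e i + (2 * length (repeat e is) + 2 * length is)
    ≡⟨ cong (2 + 2 * e i +_) (length-repeat e is) ⟩
  sum (map (λ i → 2 + 2 * e i) (i ∷ is)) ∎
  where
  open ≡-Reasoning
  rearrange : ∀ a b c → 2 * (a + b) + 2 * suc c ≡ 2 + 2 * a + (2 * b + 2 * c)
  rearrange = solve-∀

repeat-sorted : ∀ (e : Fin n → ℕ) {is} → AllPairs Fin._≤_ is → AllPairs Fin._≤_ (repeat e is)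
repeat-sorted e []                = []
repeat-sorted e {i ∷ is} (i≤ ∷ s) = AllPairs.++⁺ (const (e i)) (repeat-sorted e s)
  (All.replicate⁺ (e i) (All.tabulate λ y∈ → All.lookup i≤ (repeat-⊆ e is y∈)))
  where
  const : ∀ k → AllPairs Fin._≤_ (replicate k i)
  const zero    = []
  const (suc k) = All.replicate⁺ k (Fin.≤-refl {x = i}) ∷ const k

-- Attaching all cycles

module Build (d : Fin n → ℕ) (antitone : ∀ {i j} → i Fin.≤ j → d j ≤ d i) where

  Realization : Set
  Realization = ∃ λ G → ∃ λ xs → CactusOn xs G × (∀ x → x ∈ xs) × (∀ x → degree G x ≡ d x)

  -- A cactus on xs, still to be joined by the vertices ys, with a cycle still
  -- to be attached at each entry of u ∷ as.
  record State (u : Fin n) (as xs ys : List (Fin n)) : Set where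
    field
      graph      : SimpleGraph n
      cactusOn   : CactusOn xs graph
      u∈xs       : u ∈ xs
      cover      : ∀ x → x ∈ xs ⊎ x ∈ ys
      separate   : ∀ {x} → x ∈ ys → x ∉ xs
      ys-sorted  : AllPairs Fin._<_ ys
      as-sorted  : AllPairs Fin._≤_ as
      enough     : length (u ∷ as) * 2 ≤ length ys
      degree-xs  : ∀ {x} → x ∈ xs → degree graph x + 2 * occurrences x (u ∷ as) ≡ d x
      -- The leading 2 comes from the cycle that will bring `x` in.
      degree-ys  : ∀ {x} → x ∈ ys → 2 + 2 * occurrences x (u ∷ as) ≡ d x

  module Step {u as xs ys} (s : State u as xs ys) (zs : List (Fin n)) (zs-unique : Unique zs)
              (2≤zs : 2 ≤ length zs) (zs⊆ys : ∀ {z} → z ∈ zs → z ∈ ys) where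
    open State s
    open Attach cactusOn u∈xs zs zs-unique 2≤zs (separate ∘ zs⊆ys) public

    ys≢u : ∀ {x} → x ∈ ys → x ≢ u
    ys≢u x∈ refl = separate x∈ u∈xs

    degree-step-ys : ∀ {x} → x ∈ ys → 2 + 2 * occurrences x as ≡ d x
    degree-step-ys {x} x∈ = trans (cong (λ k → 2 + 2 * k) (sym (occurrences-there as (ys≢u x∈)))) (degree-ys x∈)

    degree-step-zs : ∀ {x} → x ∈ zs → degree attached x + 2 * occurrences x as ≡ d x
    degree-step-zs {x} x∈ = trans
      (cong (_+ 2 * occurrences x as) (trans (degree-on-ring (there x∈))
        (cong (2 +_) (CactusOn.isolated cactusOn (separate (zs⊆ys x∈))))))
      (degree-step-ys (zs⊆ys x∈))

    degree-step-xs : ∀ {x} → x ∈ xs → degree attached x + 2 * occurrences x as ≡ d x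
    degree-step-xs {x} x∈ with x ≟ u
    ... | yes refl = begin
      degree attached x + 2 * occurrences x as
        ≡⟨ cong (_+ 2 * occurrences x as) (degree-on-ring (here refl)) ⟩
      2 + degree graph x + 2 * occurrences x as
        ≡⟨ rearrange (degree graph x) (occurrences x as) ⟩
      degree graph x + 2 * suc (occurrences x as)
        ≡⟨ cong (λ k → degree graph x + 2 * k) (sym (occurrences-here x as)) ⟩
      degree graph x + 2 * occurrences x (x ∷ as)
        ≡⟨ degree-xs x∈ ⟩
      d x ∎
      where
      open ≡-Reasoning
      rearrange : ∀ a b → 2 + a + 2 * b ≡ a + 2 * suc b
      rearrange = solve-∀
    ... | no x≢u = trans
      (cong₂ (λ a b → a + 2 * b) (degree-off-ring off) (sym (occurrences-there as x≢u)))
      (degree-xs x∈)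
      where
      off : x ∉ ring
      off (here x≡u)   = x≢u x≡u
      off (there x∈zs) = separate (zs⊆ys x∈zs) x∈

    degree-step : ∀ {x} → x ∈ zs ++ xs → degree attached x + 2 * occurrences x as ≡ d x
    degree-step x∈ = [ degree-step-zs , degree-step-xs ]′ (∈-++⁻ zs x∈)

  build : ∀ u as xs ys → State u as xs ys → Realization
  -- The last cycle takes all of `ys`; with `as` empty, `enough` reads `2 ≤ length ys`.
  build u [] xs ys s = attached , ys ++ xs , attached-cactusOn , everywhere ,
    λ x → trans (sym (ℕ.+-identityʳ _)) (degree-step (everywhere x))
    where
    open State s
    open Step s ys (AllPairs.map Fin.<⇒≢ ys-sorted) enough id
    everywhere : ∀ x → x ∈ ys ++ xs
    everywhere x = [ ∈-++⁺ʳ ys , ∈-++⁺ˡ ]′ (cover x)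
  build u (u′ ∷ as) xs [] s with State.enough s
  ... | ()
  build u (u′ ∷ as) xs (y ∷ []) s with State.enough s
  ... | s≤s ()
  build u (u′ ∷ as) xs (y₁ ∷ y₂ ∷ ys) s = build u′ as (zs ++ xs) ys (record
    { graph     = attached
    ; cactusOn  = attached-cactusOn
    ; u∈xs      = reached
    ; cover     = cover′
    ; separate  = λ x∈ys x∈ → [ (λ x∈zs → zs∌ys x∈zs x∈ys) , separate (there (there x∈ys)) ]′ (∈-++⁻ zs x∈)
    ; ys-sorted = AllPairs.tail (AllPairs.tail ys-sorted)
    ; as-sorted = AllPairs.tail as-sorted
    ; enough    = ℕ.≤-pred (ℕ.≤-pred enough)
    ; degree-xs = degree-step
    ; degree-ys = degree-step-ys ∘ there ∘ there
    })
    where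
    open State s
    zs : List (Fin n)
    zs = y₁ ∷ y₂ ∷ []
    zs⊆ys : ∀ {z} → z ∈ zs → z ∈ y₁ ∷ y₂ ∷ ys
    zs⊆ys (here p)         = here p
    zs⊆ys (there (here p)) = there (here p)
    y₁< : All (y₁ Fin.<_) (y₂ ∷ ys)
    y₁< = AllPairs.head ys-sorted
    y₂< : All (y₂ Fin.<_) ys
    y₂< = AllPairs.head (AllPairs.tail ys-sorted)
    zs∌ys : ∀ {x} → x ∈ zs → x ∉ ys
    zs∌ys (here refl)         x∈ = Fin.<-irrefl refl (All.lookup y₁< (there x∈))
    zs∌ys (there (here refl)) x∈ = Fin.<-irrefl refl (All.lookup y₂< x∈)
    open Step s zs ((Fin.<⇒≢ (All.head y₁<) ∷ []) ∷ [] ∷ []) (s≤s (s≤s z≤n)) zs⊆ys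
    cover′ : ∀ x → x ∈ zs ++ xs ⊎ x ∈ ys
    cover′ x with cover x
    ... | inj₁ x∈                 = inj₁ (there (there x∈))
    ... | inj₂ (here p)           = inj₁ (here p)
    ... | inj₂ (there (here p))   = inj₁ (there (here p))
    ... | inj₂ (there (there x∈)) = inj₂ x∈
    -- If u′ were not reached yet, y₁ < u′ would have d y₁ = 2, whereas d u′ ≥ 4.
    reached : u′ ∈ zs ++ xs
    reached with cover′ u′
    ... | inj₁ u′∈ = u′∈
    ... | inj₂ u′∈ = ⊥-elim (ℕ.<⇒≱ 2<du′ (subst (d u′ ≤_) dy₁≡2 (antitone (ℕ.<⇒≤ y₁<u′))))
      where
      y₁<u′ : y₁ Fin.< u′
      y₁<u′ = All.lookup y₁< (there u′∈)
      dy₁≡2 : d y₁ ≡ 2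
      dy₁≡2 = trans (sym (degree-step-ys (here refl))) (cong (λ k → 2 + 2 * k)
        (occurrences-none (Fin.<⇒≢ y₁<u′ ∷
          All.map (λ u′≤a → Fin.<⇒≢ (ℕ.<-≤-trans y₁<u′ u′≤a)) (AllPairs.head as-sorted))))
      2<du′ : 2 < d u′
      2<du′ = subst (2 <_)
        (trans (cong (λ k → 2 + 2 * k) (sym (occurrences-here u′ as)))
               (degree-step-ys (there (there u′∈))))
        (s≤s (s≤s (s≤s z≤n)))

-- From the construction to the equivalence

cactusOn⇒bridgelessCactus : ∀ {G : SimpleGraph n} {xs} →
  CactusOn xs G → (∀ x → x ∈ xs) → IsCactus G × Bridgeless G
cactusOn⇒bridgelessCactus on full =
  record { connected = conn ; atMostOneCycle = λ u v _ c c′ C C′ l l′ → uniqueCycle C C′ l l′ }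
  , edgesOnCycles⇒bridgeless conn onCycles
  where
  open CactusOn on
  conn = λ u v → connected (full u) (full v)

module _ {m : ℕ} (d : Fin (suc m) → ℕ) (antitone : ∀ {i j} → i Fin.≤ j → d j ≤ d i)
         (e : Fin (suc m) → ℕ) (d≡ : ∀ i → d i ≡ 2 + 2 * e i)
         (bound : sum (map d (allFin (suc m))) ≤ 3 * m) where
  open Build d antitone

  private
    vertices = allFin (suc m)
    as = repeat e vertices
    ys = List.tabulate {n = m} Fin.suc

    occurrences-as : ∀ x → occurrences x as ≡ e x
    occurrences-as x = occurrences-repeat e (Unique.allFin⁺ (suc m)) (∈-allFin x)

    cover : ∀ x → x ∈ [ Fin.zero ] ⊎ x ∈ ys
    cover Fin.zero    = inj₁ (here refl)
    cover (Fin.suc x) = inj₂ (∈-tabulate⁺ x)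

    ys∌zero : ∀ {x} → x ∈ ys → x ∉ [ Fin.zero ]
    ys∌zero x∈ (here refl) with ∈-tabulate⁻ x∈
    ... | _ , ()

    -- The degree sum is `2 * length as + 2 * suc m`, so the bound `3 * m` leaves
    -- `2 * suc (length as) ≤ m`, and `m` vertices besides `Fin.zero` are available.
    enough : suc (length as) * 2 ≤ length ys
    enough = subst (suc (length as) * 2 ≤_) (sym (length-tabulate {n = m} Fin.suc))
      (ℕ.+-cancelʳ-≤ (2 * m) _ m (begin
      suc (length as) * 2 + 2 * m            ≡⟨ rearrange (length as) m ⟩
      2 * length as + 2 * suc m              ≡⟨ cong (λ k → 2 * length as + 2 * k)
                                                     (sym (length-tabulate {n = suc m} id)) ⟩
      2 * length as + 2 * length vertices    ≡⟨ length-repeat e vertices ⟩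
      sum (map (λ i → 2 + 2 * e i) vertices) ≡⟨ cong sum (map-cong (sym ∘ d≡) vertices) ⟩
      sum (map d vertices)                   ≤⟨ bound ⟩
      m + 2 * m                              ∎))
      where
      open ℕ.≤-Reasoning
      rearrange : ∀ a m → suc a * 2 + 2 * m ≡ 2 * a + 2 * suc m
      rearrange = solve-∀

    initial : State Fin.zero as [ Fin.zero ] ys
    initial = record
      { graph     = emptyGraph
      ; cactusOn  = emptyGraph-cactusOn Fin.zero
      ; u∈xs      = here refl
      ; cover     = cover
      ; separate  = ys∌zero
      ; ys-sorted = AllPairs.tabulate⁺-< s≤s
      ; as-sorted = repeat-sorted e (AllPairs.tabulate⁺-< ℕ.<⇒≤)
      ; enough    = enough
      ; degree-xs = degree-xs
      ; degree-ys = degree-ys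
      }
      where
      -- No cycle brings `Fin.zero` in; the extra entry at the head of the list supplies its first
      -- two edges.
      degree-xs : ∀ {x} → x ∈ [ Fin.zero ] →
                  degree (emptyGraph {suc m}) x + 2 * occurrences x (Fin.zero ∷ as) ≡ d x
      degree-xs {x} (here refl) = begin
        degree (emptyGraph {suc m}) x + 2 * occurrences x (x ∷ as)
          ≡⟨ cong₂ (λ a b → a + 2 * b) (emptyGraph-degree x)
               (trans (occurrences-here x as) (cong suc (occurrences-as x))) ⟩
        2 * suc (e x)  ≡⟨ ℕ.*-suc 2 (e x) ⟩
        2 + 2 * e x    ≡⟨ sym (d≡ x) ⟩
        d x            ∎
        where open ≡-Reasoning
      degree-ys : ∀ {x} → x ∈ ys → 2 + 2 * occurrences x (Fin.zero ∷ as) ≡ d x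
      degree-ys {x} x∈ = trans
        (cong (λ k → 2 + 2 * k)
          (trans (occurrences-there as (λ { refl → ys∌zero x∈ (here refl) })) (occurrences-as x)))
        (sym (d≡ x))

  bridgelessCactus : ∃ λ G → IsCactus G × Bridgeless G × (∀ x → degree G x ≡ d x)
  bridgelessCactus with build Fin.zero as [ Fin.zero ] ys initial
  ... | G , xs , on , full , deg =
    let cactus , bridgeless = cactusOn⇒bridgelessCactus on full in G , cactus , bridgeless , deg

theorem5p2 : ∀ (n : ℕ) (d : Vec ℕ n) → 3 ≤ n → IsDegreeSequence d →
    (∃ λ (G : SimpleGraph n) → Realizes G d × IsCactus G × Bridgeless G)
    ⇔ (halfSum d ≤ (3 * (n ∸ 1)) / 2 × (∀ i → 2 ∣ lookup d i))
theorem5p2 (suc m) d 3≤n isDeg = mk⇔ necessary sufficient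
  where
  open IsDegreeSequence isDeg

  necessary : (∃ λ G → Realizes G d × IsCactus G × Bridgeless G) →
              halfSum d ≤ (3 * m) / 2 × (∀ i → 2 ∣ lookup d i)
  necessary (G , real , cactus , bridgeless) =
    -- Halving with rounding down is monotone, so the bound on the degree sum is enough.
    /-mono-≤ (subst (_≤ 3 * m) total (degree-sum-bound Fin.zero)) (ℕ.≤-refl {2}) ,
    λ i → subst (2 ∣_) (real i) (degree-even i)
    where
    open Necessity G cactus bridgeless
    total : sum (map (λ v → length (neighbourList G v)) (allFin (suc m))) ≡ Vec.sum d
    total = trans
      (cong sum (map-cong (λ v → trans (sym (degree≡length-neighbourList G v)) (real v)) (allFin (suc m))))
      (sym (sum-lookup d))

  sufficient : halfSum d ≤ (3 * m) / 2 × (∀ i → 2 ∣ lookup d i) →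
               ∃ λ G → Realizes G d × IsCactus G × Bridgeless G
  sufficient (half≤ , even) =
    let G , cactus , bridgeless , deg = bridgelessCactus (lookup d) (nonincreasing _ _)
          (λ i → proj₁ (halve i)) (λ i → proj₂ (halve i)) (subst (_≤ 3 * m) (sum-lookup d) sum≤)
    in G , deg , cactus , bridgeless
    where
    halve : ∀ i → ∃ λ k → lookup d i ≡ 2 + 2 * k
    halve i with lookup d i | positive i | even i
    -- Positivity excludes the quotient 0; a quotient `suc k` leaves `k` cycles to attach at `i`.
    ... | _ | () | divides zero refl
    ... | _ | _  | divides (suc k) refl = k , cong (2 +_) (ℕ.*-comm k 2)
    sum≤ : Vec.sum d ≤ 3 * m
    -- `evenSum` makes the halving of the degree sum exact, so doubling `half≤` recovers the full
    -- sum, and rounding on the right only lowers the bound.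
    sum≤ = begin
      Vec.sum d           ≡⟨ m/n*n≡m evenSum ⟨
      Vec.sum d / 2 * 2   ≤⟨ ℕ.*-monoˡ-≤ 2 half≤ ⟩
      (3 * m) / 2 * 2     ≤⟨ m/n*n≤m (3 * m) 2 ⟩
      3 * m               ∎
      where open ℕ.≤-Reasoning
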